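{- Every typable term of the full calculus T^{⊕,R,X} is almost-surely terminating: for every typable term M, Succ(M) = 1, i.e. its evaluation ⟦M⟧ is a value distribution of total mass 1.
   Context: T^{⊕,R,X} is Gödel's System T (simply typed λ-calculus with natural numbers 0, S, pairs with projections π₁, π₂, and a primitive recursor rec of type (A × (NAT→A→A) × NAT) → A) extended with three probabilistic choice operators: a binary choice M ⊕ N, which reduces to M or N with probability 1/2 each; a constant R : NAT, which reduces to the numeral n with probability 1/2^{n+1}; and X : ((A→A) × A) → A, where X⟨V,W⟩ reduces to V (X⟨V,W⟩) or to W with probability 1/2 each. Reduction is weak call-by-value and is lifted to (sub)distributions over closed terms. If M →^{≤ n} 𝓜_n (at most n reduction steps, values staying fixed), the evaluation ⟦M⟧ maps each value V to lim_n 𝓜_n(V), and Succ(M) is the total mass of ⟦M⟧. A term is almost-surely terminating (AST) when Succ(M) = 1. -}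

module Defs where

open import Data.Nat using (ℕ; zero; suc)
open import Data.Bool using (Bool; true; false; _∧_; if_then_else_)
open import Data.Product using (_×_; _,_; proj₁; proj₂; Σ; ∃)
open import Data.List using (List; []; _∷_)
open import Data.Rational using (ℚ; 0ℚ; 1ℚ; ½; _+_; _*_; _-_; _≤_; _<_)

infixr 7 _⇒_
infixr 8 _×ᵗ_

data Ty : Set where
  NAT  : Ty
  _⇒_  : Ty → Ty → Ty
  _×ᵗ_ : Ty → Ty → Ty

-- Raw terms (de Bruijn indices).  rec and X are constants of function
-- type; a triple ⟨M,N,P⟩ is the nested pair ⟨M,⟨N,P⟩⟩.

data Term : Set where
  var  : ℕ → Term
  lam  : Term → Term
  app  : Term → Term → Term
  zer  : Term
  suc′ : Term → Term
  pair : Term → Term → Term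
  π₁   : Term → Term
  π₂   : Term → Term
  rec  : Term
  _⊕_  : Term → Term → Term
  R    : Term
  X    : Term

numeral : ℕ → Term
numeral zero    = zer
numeral (suc n) = suc′ (numeral n)

data _∋_∶_ : List Ty → ℕ → Ty → Set where
  here  : ∀ {Γ A} → (A ∷ Γ) ∋ zero ∶ A
  there : ∀ {Γ A B i} → Γ ∋ i ∶ A → (B ∷ Γ) ∋ suc i ∶ A

data _⊢_∶_ (Γ : List Ty) : Term → Ty → Set where
  ⊢var  : ∀ {i A} → Γ ∋ i ∶ A → Γ ⊢ var i ∶ A
  ⊢lam  : ∀ {M A B} → (A ∷ Γ) ⊢ M ∶ B → Γ ⊢ lam M ∶ (A ⇒ B)
  ⊢app  : ∀ {M N A B} → Γ ⊢ M ∶ (A ⇒ B) → Γ ⊢ N ∶ A → Γ ⊢ app M N ∶ B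
  ⊢zer  : Γ ⊢ zer ∶ NAT
  ⊢suc  : ∀ {M} → Γ ⊢ M ∶ NAT → Γ ⊢ suc′ M ∶ NAT
  ⊢pair : ∀ {M N A B} → Γ ⊢ M ∶ A → Γ ⊢ N ∶ B → Γ ⊢ pair M N ∶ (A ×ᵗ B)
  ⊢π₁   : ∀ {M A B} → Γ ⊢ M ∶ (A ×ᵗ B) → Γ ⊢ π₁ M ∶ A
  ⊢π₂   : ∀ {M A B} → Γ ⊢ M ∶ (A ×ᵗ B) → Γ ⊢ π₂ M ∶ B
  ⊢rec  : ∀ {A} → Γ ⊢ rec ∶ ((A ×ᵗ ((NAT ⇒ A ⇒ A) ×ᵗ NAT)) ⇒ A)
  ⊢⊕    : ∀ {M N A} → Γ ⊢ M ∶ A → Γ ⊢ N ∶ A → Γ ⊢ (M ⊕ N) ∶ A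
  ⊢R    : Γ ⊢ R ∶ NAT
  ⊢X    : ∀ {A} → Γ ⊢ X ∶ (((A ⇒ A) ×ᵗ A) ⇒ A)

ext : (ℕ → ℕ) → ℕ → ℕ
ext ρ zero    = zero
ext ρ (suc i) = suc (ρ i)

rename : (ℕ → ℕ) → Term → Term
rename ρ (var i)    = var (ρ i)
rename ρ (lam M)    = lam (rename (ext ρ) M)
rename ρ (app M N)  = app (rename ρ M) (rename ρ N)
rename ρ zer        = zer
rename ρ (suc′ M)   = suc′ (rename ρ M)
rename ρ (pair M N) = pair (rename ρ M) (rename ρ N)
rename ρ (π₁ M)     = π₁ (rename ρ M)
rename ρ (π₂ M)     = π₂ (rename ρ M)
rename ρ rec        = rec
rename ρ (M ⊕ N)    = rename ρ M ⊕ rename ρ N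
rename ρ R          = R
rename ρ X          = X

exts : (ℕ → Term) → ℕ → Term
exts σ zero    = var zero
exts σ (suc i) = rename suc (σ i)

subst : (ℕ → Term) → Term → Term
subst σ (var i)    = σ i
subst σ (lam M)    = lam (subst (exts σ) M)
subst σ (app M N)  = app (subst σ M) (subst σ N)
subst σ zer        = zer
subst σ (suc′ M)   = suc′ (subst σ M)
subst σ (pair M N) = pair (subst σ M) (subst σ N)
subst σ (π₁ M)     = π₁ (subst σ M)
subst σ (π₂ M)     = π₂ (subst σ M)
subst σ rec        = rec
subst σ (M ⊕ N)    = subst σ M ⊕ subst σ N
subst σ R          = R
subst σ X          = X

single : Term → ℕ → Term
single V zero    = V
single V (suc i) = var i

_[_] : Term → Term → Term
M [ V ] = subst (single V) M

isValue : Term → Bool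
isValue (lam _)    = true
isValue zer        = true
isValue (suc′ V)   = isValue V
isValue (pair V W) = isValue V ∧ isValue W
isValue rec        = true
isValue X          = true
isValue _          = false

-- (Sub)distributions over terms with countable support, presented as
-- sequences of weighted terms; the mass D(M) of a term M is the sum of
-- the weights of all entries equal to M.

Dist : Set
Dist = ℕ → ℚ × Term

dirac : Term → Dist
dirac M zero    = 1ℚ , M
dirac M (suc _) = 0ℚ , M

twoPoint : Term → Term → Dist
twoPoint M N zero          = ½ , M
twoPoint M N (suc zero)    = ½ , N
twoPoint M N (suc (suc _)) = 0ℚ , M

mapD : (Term → Term) → Dist → Dist
mapD f D i = proj₁ (D i) , f (proj₂ (D i))

half^ : ℕ → ℚ
half^ zero    = 1ℚ
half^ (suc n) = ½ * half^ n

Rdist : Dist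
Rdist n = half^ (suc n) , numeral n

-- One step of weak call-by-value reduction of a single term, as a
-- distribution.  Values (and stuck terms) are kept fixed.

redex : Term → Term → Dist
redex (lam B) V = dirac (B [ V ])
redex rec (pair V (pair W zer))      = dirac V
redex rec (pair V (pair W (suc′ Z))) =
  dirac (app (app W Z) (app rec (pair V (pair W Z))))
redex X (pair V W) = twoPoint (app V (app X (pair V W))) W
redex M N = dirac (app M N)

step : Term → Dist
step (app M N) =
  if isValue M
  then (if isValue N then redex M N else mapD (app M) (step N))
  else mapD (λ M′ → app M′ N) (step M)
step (suc′ M) = if isValue M then dirac (suc′ M) else mapD suc′ (step M)
step (pair M N) =
  if isValue M
  then (if isValue N then dirac (pair M N) else mapD (pair M) (step N))
  else mapD (λ M′ → pair M′ N) (step M)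
step (π₁ M) with isValue M | M
... | true  | pair V W = dirac V
... | true  | M′       = dirac (π₁ M′)
... | false | M′       = mapD π₁ (step M′)
step (π₂ M) with isValue M | M
... | true  | pair V W = dirac W
... | true  | M′       = dirac (π₂ M′)
... | false | M′       = mapD π₂ (step M′)
step (M ⊕ N) = twoPoint M N
step R       = Rdist
step M       = dirac M

-- Lifting reduction to distributions, using a bijection ℕ ≅ ℕ × ℕ.

unpair : ℕ → ℕ × ℕ
unpair zero = zero , zero
unpair (suc n) with unpair n
... | zero  , b = suc b , zero
... | suc a , b = a , suc b

stepD : Dist → Dist
stepD D i with unpair i
... | j , k with D j
... | p , M with step M k
... | q , N = p * q , N

evalN : ℕ → Term → Dist
evalN zero    M = dirac M
evalN (suc n) M = stepD (evalN n M)

valueMass : Dist → ℕ → ℚ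
valueMass D zero    = 0ℚ
valueMass D (suc K) =
  valueMass D K + (if isValue (proj₂ (D K)) then proj₁ (D K) else 0ℚ)

-- Succ(M) = Σ_V ⟦M⟧(V) = Σ_V lim_n 𝓜_n(V) = sup_n 𝓜_n(values)
-- (monotone convergence; all weights are non-negative).  Since the
-- sequence of masses is non-decreasing, "Succ(M) = 1" means: every
-- partial value mass is ≤ 1, and it gets arbitrarily close to 1.
Succ≡1 : Term → Set
Succ≡1 M =
  ((n K : ℕ) → valueMass (evalN n M) K ≤ 1ℚ) ×
  ((ε : ℚ) → 0ℚ < ε → Σ ℕ λ n → Σ ℕ λ K → 1ℚ - ε ≤ valueMass (evalN n M) K)

AST : Term → Set
AST M = Succ≡1 M

{-# OPTIONS --safe #-}
-- Reducibility with a failure budget.  A finite reduction tree that abandons some branches certifies a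
-- lower bound on the probability of reaching a value satisfying P; a term converges into P if such
-- trees exist for every bound 1 - 2^-k.  Since the trees are finite, convergence composes along
-- evaluation contexts, the failure probabilities of the two stages adding up (reach-bind), so the usual
-- logical-relations argument goes through.  For X, cutting the geometric number of unfoldings at n
-- leaves an ordinary n-fold iteration and costs 2^-n.  Finally a finite tree of depth n bounds the
-- value mass of evalN n from below, via rearrangement of double sums along the enumeration unpair.
module Submission where

open import Defs
open import Data.Bool using (Bool; true; false; _∧_; if_then_else_)
open import Data.Bool.Properties using (∧-zeroʳ)
import Data.Integer.Base as ℤ
open import Data.List using (List; []; _∷_)
open import Data.Nat.Base as ℕ using (ℕ; zero; suc; z≤n; s≤s)
import Data.Nat.Properties as ℕ
open import Data.Product using (Σ; _×_; _,_; proj₁; proj₂)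
open import Data.Rational using (ℚ; mkℚ; 0ℚ; 1ℚ; ½; _+_; _*_; _-_; -_; _≤_; _<_; *<*; nonNegative; toℚᵘ)
import Data.Rational.Properties as ℚ
open import Data.Rational.Solver using (module +-*-Solver)
import Data.Rational.Unnormalised.Base as ℚᵘ
import Data.Rational.Unnormalised.Properties as ℚᵘ
open import Data.Sum using (inj₁; inj₂)
open import Function using (_∘_)
open import Relation.Binary.PropositionalEquality
  using (_≡_; _≗_; refl; sym; trans; cong; cong₂; module ≡-Reasoning)
  renaming (subst to transport)
open +-*-Solver using (solve; con; _:=_; _:+_; _:*_; _:-_)

-- Rational arithmetic

*-monoˡ : ∀ {p q r} → 0ℚ ≤ p → q ≤ r → p * q ≤ p * r
*-monoˡ {p} 0≤p = ℚ.*-monoˡ-≤-nonNeg p {{nonNegative 0≤p}}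

*-nonNeg : ∀ {p q} → 0ℚ ≤ p → 0ℚ ≤ q → 0ℚ ≤ p * q
*-nonNeg {p} 0≤p 0≤q = ℚ.≤-trans (ℚ.≤-reflexive (sym (ℚ.*-zeroʳ p))) (*-monoˡ 0≤p 0≤q)

+-nonNeg : ∀ {p q} → 0ℚ ≤ p → 0ℚ ≤ q → 0ℚ ≤ p + q
+-nonNeg = ℚ.+-mono-≤

p≤p+q : ∀ {p q} → 0ℚ ≤ q → p ≤ p + q
p≤p+q {p} 0≤q = ℚ.≤-trans (ℚ.≤-reflexive (sym (ℚ.+-identityʳ p))) (ℚ.+-monoʳ-≤ p 0≤q)

p-q≤p : ∀ {p q} → 0ℚ ≤ q → p - q ≤ p
p-q≤p {p} 0≤q = ℚ.≤-trans (ℚ.+-monoʳ-≤ p (ℚ.neg-antimono-≤ 0≤q)) (ℚ.≤-reflexive (ℚ.+-identityʳ p))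

0≤½ : 0ℚ ≤ ½
0≤½ = ℚ.nonNegative⁻¹ ½

0≤1 : 0ℚ ≤ 1ℚ
0≤1 = ℚ.nonNegative⁻¹ 1ℚ

half^-nonNeg : ∀ n → 0ℚ ≤ half^ n
half^-nonNeg zero    = 0≤1
half^-nonNeg (suc n) = *-nonNeg 0≤½ (half^-nonNeg n)

half^-double : ∀ n → half^ n ≡ half^ (suc n) + half^ (suc n)
half^-double n = solve 1 (λ h → h := con ½ :* h :+ con ½ :* h) refl (half^ n)

1-half^-split : ∀ n → 1ℚ - half^ n ≡ 1ℚ - half^ (suc n) - half^ (suc n)
1-half^-split n = solve 1 (λ h → con 1ℚ :- h := con 1ℚ :- con ½ :* h :- con ½ :* h) refl (half^ n)

-- Halving `1/(n+1)` gives `1/(2n+2)`, which is at most `1/(n+2)`. Unnormalised rationals let this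
-- be checked by cross-multiplication, without reducing fractions.
half^≤unitFraction : ∀ n → toℚᵘ (half^ n) ℚᵘ.≤ ℚᵘ.mkℚᵘ (ℤ.+ 1) n
half^≤unitFraction zero    = ℚᵘ.≤-refl
half^≤unitFraction (suc n) = begin
  toℚᵘ (½ * half^ n)                ≃⟨ ℚ.toℚᵘ-homo-* ½ (half^ n) ⟩
  toℚᵘ ½ ℚᵘ.* toℚᵘ (half^ n)        ≤⟨ ℚᵘ.*-monoʳ-≤-nonNeg (toℚᵘ ½) (half^≤unitFraction n) ⟩
  toℚᵘ ½ ℚᵘ.* ℚᵘ.mkℚᵘ (ℤ.+ 1) n ≤⟨ ℚᵘ.*≤* (ℤ.+≤+ cross-multiplied) ⟩
  ℚᵘ.mkℚᵘ (ℤ.+ 1) (suc n)           ∎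
  where
  open ℚᵘ.≤-Reasoning
  cross-multiplied : 1 ℕ.* suc (suc n) ℕ.≤ 1 ℕ.* (2 ℕ.* suc n)
  cross-multiplied = ℕ.*-monoʳ-≤ 1 (s≤s (ℕ.≤-trans (ℕ.m≤n+m (suc n) n) (ℕ.+-monoʳ-≤ n (ℕ.m≤m+n (suc n) 0))))

half^-archimedean : ∀ {ε} → 0ℚ < ε → Σ ℕ λ k → half^ k ≤ ε
half^-archimedean {mkℚ (ℤ.+ 0) d _} (*<* (ℤ.+<+ ()))
half^-archimedean {mkℚ (ℤ.-[1+ _ ]) d _} (*<* ())
-- `mkℚ` stores the denominator minus one, so the given rational is at least `1/(d+1)`, and `d`
-- itself serves as exponent.
half^-archimedean {mkℚ ℤ.+[1+ n ] d _} _ = d , ℚ.toℚᵘ-cancel-≤ (ℚᵘ.≤-trans (half^≤unitFraction d)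
  (ℚᵘ.*≤* (ℤ.+≤+ (ℕ.*-monoˡ-≤ (suc d) (s≤s (z≤n {n}))))))

-- Finite sums

sum : (ℕ → ℚ) → ℕ → ℚ
sum f zero    = 0ℚ
sum f (suc n) = sum f n + f n

sum-cong : ∀ {f g} → f ≗ g → ∀ n → sum f n ≡ sum g n
sum-cong f≗g zero    = refl
sum-cong f≗g (suc n) = cong₂ _+_ (sum-cong f≗g n) (f≗g n)

sum-nonNeg : ∀ {f} → (∀ i → 0ℚ ≤ f i) → ∀ n → 0ℚ ≤ sum f n
sum-nonNeg f≥0 zero    = ℚ.≤-refl
sum-nonNeg f≥0 (suc n) = +-nonNeg (sum-nonNeg f≥0 n) (f≥0 n)

sum-mono-< : ∀ {f g} n → (∀ i → i ℕ.< n → f i ≤ g i) → sum f n ≤ sum g n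
sum-mono-< zero    f≤g = ℚ.≤-refl
sum-mono-< (suc n) f≤g = ℚ.+-mono-≤ (sum-mono-< n λ i i<n → f≤g i (ℕ.m<n⇒m<1+n i<n)) (f≤g n ℕ.≤-refl)

sum-mono : ∀ {f g} → (∀ i → f i ≤ g i) → ∀ n → sum f n ≤ sum g n
sum-mono f≤g n = sum-mono-< n λ i _ → f≤g i

sum-monoʳ : ∀ {f m n} → (∀ i → 0ℚ ≤ f i) → m ℕ.≤ n → sum f m ≤ sum f n
sum-monoʳ {f} {m} f≥0 m≤n = go (ℕ.≤⇒≤′ m≤n)
  where
  go : ∀ {n} → m ℕ.≤′ n → sum f m ≤ sum f n
  go (ℕ.≤′-reflexive refl) = ℚ.≤-refl
  go (ℕ.≤′-step {n} m≤n)   = ℚ.≤-trans (go m≤n) (p≤p+q (f≥0 n))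

sum-*ˡ : ∀ c f n → sum (λ i → c * f i) n ≡ c * sum f n
sum-*ˡ c f zero    = sym (ℚ.*-zeroʳ c)
sum-*ˡ c f (suc n) = trans (cong (_+ c * f n) (sum-*ˡ c f n)) (sym (ℚ.*-distribˡ-+ c (sum f n) (f n)))

sum-head : ∀ f n → sum f (suc n) ≡ f 0 + sum (f ∘ suc) n
sum-head f zero    = trans (ℚ.+-identityˡ (f 0)) (sym (ℚ.+-identityʳ (f 0)))
sum-head f (suc n) = trans (cong (_+ f (suc n)) (sum-head f n)) (ℚ.+-assoc (f 0) _ _)

sum-half^ : ∀ n → sum (half^ ∘ suc) n ≡ 1ℚ - half^ n
sum-half^ zero    = refl
sum-half^ (suc n) = begin
  sum (half^ ∘ suc) n + ½ * half^ n ≡⟨ cong (_+ ½ * half^ n) (sum-half^ n) ⟩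
  1ℚ - half^ n + ½ * half^ n        ≡⟨ collect (half^ n) ⟩
  1ℚ - ½ * half^ n                  ∎
  where
  open ≡-Reasoning
  collect : ∀ h → 1ℚ - h + ½ * h ≡ 1ℚ - ½ * h
  collect = solve 1 (λ h → con 1ℚ :- h :+ con ½ :* h := con 1ℚ :- con ½ :* h) refl

-- Sums along the enumeration unpair of ℕ × ℕ

-- The entries from `(a , b)` down to `(0 , a + b)`, in the order in which `unpair` visits them.
antidiagonal : (ℕ → ℕ → ℚ) → ℕ → ℕ → ℚ
antidiagonal g zero    b = g zero b
antidiagonal g (suc a) b = g (suc a) b + antidiagonal g a (suc b)

-- The sum over all `(j , k)` with `j + k < s`, arranged by rows so that bounds on single rows apply
-- by induction.
triangle : (ℕ → ℕ → ℚ) → ℕ → ℚ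
triangle g zero    = 0ℚ
triangle g (suc s) = sum (g 0) (suc s) + triangle (g ∘ suc) s

-- The definition peels off the entry with the largest row index; the row-wise `triangle` needs the
-- entry in row 0 instead.
antidiagonal-last : ∀ g a b → antidiagonal g (suc a) b ≡ antidiagonal (g ∘ suc) a b + g 0 (suc a ℕ.+ b)
antidiagonal-last g zero    b = refl
antidiagonal-last g (suc a) b = begin
  g (2 ℕ.+ a) b + antidiagonal g (suc a) (suc b)
    ≡⟨ cong (g (2 ℕ.+ a) b +_) (antidiagonal-last g a (suc b)) ⟩
  g (2 ℕ.+ a) b + (antidiagonal (g ∘ suc) a (suc b) + g 0 (suc a ℕ.+ suc b))
    ≡⟨ sym (ℚ.+-assoc (g (2 ℕ.+ a) b) _ _) ⟩
  antidiagonal (g ∘ suc) (suc a) b + g 0 (suc a ℕ.+ suc b)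
    ≡⟨ cong (λ n → antidiagonal (g ∘ suc) (suc a) b + g 0 n) (ℕ.+-suc (suc a) b) ⟩
  antidiagonal (g ∘ suc) (suc a) b + g 0 (suc (suc a) ℕ.+ b) ∎
  where open ≡-Reasoning

-- Enlarging the triangle lengthens each row by one entry and adds one new row; the new entries are
-- exactly the next antidiagonal. This links summation by rows to the order of enumeration.
triangle-suc : ∀ g s → triangle g (suc s) ≡ triangle g s + antidiagonal g s 0
triangle-suc g zero    = ℚ.+-identityʳ (0ℚ + g 0 0)
triangle-suc g (suc s) = begin
  sum (g 0) (suc s) + g 0 (suc s) + triangle (g ∘ suc) (suc s)
    ≡⟨ cong (sum (g 0) (suc s) + g 0 (suc s) +_) (triangle-suc (g ∘ suc) s) ⟩
  sum (g 0) (suc s) + g 0 (suc s) + (triangle (g ∘ suc) s + antidiagonal (g ∘ suc) s 0)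
    ≡⟨ solve 4 (λ a b c d → a :+ b :+ (c :+ d) := a :+ c :+ (d :+ b)) refl
         (sum (g 0) (suc s)) (g 0 (suc s)) (triangle (g ∘ suc) s) (antidiagonal (g ∘ suc) s 0) ⟩
  triangle g (suc s) + (antidiagonal (g ∘ suc) s 0 + g 0 (suc s))
    ≡⟨ cong (λ n → triangle g (suc s) + (antidiagonal (g ∘ suc) s 0 + g 0 n)) (sym (ℕ.+-identityʳ (suc s))) ⟩
  triangle g (suc s) + (antidiagonal (g ∘ suc) s 0 + g 0 (suc s ℕ.+ 0))
    ≡⟨ cong (triangle g (suc s) +_) (sym (antidiagonal-last g s 0)) ⟩
  triangle g (suc s) + antidiagonal g (suc s) 0 ∎
  where open ≡-Reasoning

sum-unpair : (ℕ → ℕ → ℚ) → ℕ → ℚ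
sum-unpair g = sum (λ i → g (proj₁ (unpair i)) (proj₂ (unpair i)))

unpair-suc : ∀ {n a b} → unpair n ≡ (suc a , b) → unpair (suc n) ≡ (a , suc b)
unpair-suc {n} eq with unpair n
unpair-suc refl | _ = refl

unpair-turn : ∀ {n b} → unpair n ≡ (zero , b) → unpair (suc n) ≡ (suc b , zero)
unpair-turn {n} eq with unpair n
unpair-turn refl | _ = refl

-- From `(a , b)` it takes `a` steps to finish the antidiagonal and one more to turn to the start of
-- the next.
unpair-antidiagonal : ∀ a {b} n → unpair n ≡ (a , b) → unpair (suc a ℕ.+ n) ≡ (suc (a ℕ.+ b) , 0)
unpair-antidiagonal zero        n eq = unpair-turn {n} eq
unpair-antidiagonal (suc a) {b} n eq = begin
  unpair (suc (suc a ℕ.+ n))  ≡⟨ cong unpair (sym (ℕ.+-suc (suc a) n)) ⟩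
  unpair (suc a ℕ.+ suc n)    ≡⟨ unpair-antidiagonal a (suc n) (unpair-suc {n} eq) ⟩
  (suc (a ℕ.+ suc b) , 0)     ≡⟨ cong (λ c → suc c , 0) (ℕ.+-suc a b) ⟩
  (suc (suc a ℕ.+ b) , 0)     ∎
  where open ≡-Reasoning

sum-unpair-antidiagonal : ∀ g a {b} n → unpair n ≡ (a , b) →
  sum-unpair g (suc a ℕ.+ n) ≡ sum-unpair g n + antidiagonal g a b
sum-unpair-antidiagonal g zero        n eq = cong (λ jk → sum-unpair g n + g (proj₁ jk) (proj₂ jk)) eq
sum-unpair-antidiagonal g (suc a) {b} n eq = begin
  sum-unpair g (suc (suc a ℕ.+ n))
    ≡⟨ cong (sum-unpair g) (sym (ℕ.+-suc (suc a) n)) ⟩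
  sum-unpair g (suc a ℕ.+ suc n)
    ≡⟨ sum-unpair-antidiagonal g a (suc n) (unpair-suc {n} eq) ⟩
  sum-unpair g (suc n) + antidiagonal g a (suc b)
    ≡⟨ cong (λ jk → sum-unpair g n + g (proj₁ jk) (proj₂ jk) + antidiagonal g a (suc b)) eq ⟩
  sum-unpair g n + g (suc a) b + antidiagonal g a (suc b)
    ≡⟨ ℚ.+-assoc (sum-unpair g n) (g (suc a) b) _ ⟩
  sum-unpair g n + antidiagonal g (suc a) b ∎
  where open ≡-Reasoning

-- The index at which `unpair` starts the antidiagonal through `(s , 0)`.
triangular : ℕ → ℕ
triangular zero    = zero
triangular (suc s) = suc s ℕ.+ triangular s

unpair-triangular : ∀ s → unpair (triangular s) ≡ (s , 0)
unpair-triangular zero    = refl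
unpair-triangular (suc s) = trans
  (unpair-antidiagonal s (triangular s) (unpair-triangular s))
  (cong (λ n → suc n , 0) (ℕ.+-identityʳ s))

sum-triangular : ∀ g s → sum-unpair g (triangular s) ≡ triangle g s
sum-triangular g zero    = refl
sum-triangular g (suc s) = begin
  sum-unpair g (suc s ℕ.+ triangular s)                   ≡⟨ sum-unpair-antidiagonal g s (triangular s) (unpair-triangular s) ⟩
  sum-unpair g (triangular s) + antidiagonal g s 0        ≡⟨ cong (_+ antidiagonal g s 0) (sum-triangular g s) ⟩
  triangle g s + antidiagonal g s 0                       ≡⟨ triangle-suc g s ⟨
  triangle g (suc s)                                      ∎
  where open ≡-Reasoning

n≤triangular : ∀ n → n ℕ.≤ triangular n
n≤triangular zero    = z≤n
n≤triangular (suc n) = ℕ.m≤m+n (suc n) (triangular n)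

triangle≤rows : ∀ {g p} → (∀ j n → sum (g j) n ≤ p j) → ∀ s → triangle g s ≤ sum p s
triangle≤rows         rows≤p zero    = ℚ.≤-refl
triangle≤rows {g} {p} rows≤p (suc s) = begin
  sum (g 0) (suc s) + triangle (g ∘ suc) s ≤⟨ ℚ.+-mono-≤ (rows≤p 0 (suc s)) (triangle≤rows (rows≤p ∘ suc) s) ⟩
  p 0 + sum (p ∘ suc) s                    ≡⟨ sum-head p s ⟨
  sum p (suc s)                            ∎
  where open ℚ.≤-Reasoning

-- If `j < J` and `k < K` then `j + k < J + K`, so the rectangle lies inside the triangle, and the
-- remaining entries are non-negative.
rectangle≤triangle : ∀ {g} → (∀ j k → 0ℚ ≤ g j k) → ∀ J K →
  sum (λ j → sum (g j) K) J ≤ triangle g (J ℕ.+ K)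
rectangle≤triangle g≥0 zero    zero    = ℚ.≤-refl
rectangle≤triangle g≥0 zero    (suc K) =
  +-nonNeg (sum-nonNeg (g≥0 0) (suc K)) (rectangle≤triangle (g≥0 ∘ suc) zero K)
rectangle≤triangle {g} g≥0 (suc J) K = begin
  sum (λ j → sum (g j) K) (suc J)
    ≡⟨ sum-head (λ j → sum (g j) K) J ⟩
  sum (g 0) K + sum (λ j → sum (g (suc j)) K) J
    ≤⟨ ℚ.+-mono-≤ (sum-monoʳ (g≥0 0) (ℕ.m≤n⇒m≤1+n (ℕ.m≤n+m K J))) (rectangle≤triangle (g≥0 ∘ suc) J K) ⟩
  sum (g 0) (suc (J ℕ.+ K)) + triangle (g ∘ suc) (J ℕ.+ K) ∎
  where open ℚ.≤-Reasoning

-- A finite substitute for exchanging infinite sums: any prefix of the enumeration sits inside a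
-- triangle, whose rows are bounded one by one. It shows that flattening creates no mass;
-- `rectangle≤sum-unpair` shows that it loses none.
sum-unpair≤rows : ∀ {g p} → (∀ j k → 0ℚ ≤ g j k) → (∀ j n → sum (g j) n ≤ p j) →
  ∀ n → sum-unpair g n ≤ sum p n
sum-unpair≤rows {g} {p} g≥0 rows≤p n = begin
  sum-unpair g n              ≤⟨ sum-monoʳ (λ i → g≥0 (proj₁ (unpair i)) (proj₂ (unpair i))) (n≤triangular n) ⟩
  sum-unpair g (triangular n) ≡⟨ sum-triangular g n ⟩
  triangle g n                ≤⟨ triangle≤rows rows≤p n ⟩
  sum p n                     ∎
  where open ℚ.≤-Reasoning

rectangle≤sum-unpair : ∀ {g} → (∀ j k → 0ℚ ≤ g j k) → ∀ J K →
  sum (λ j → sum (g j) K) J ≤ sum-unpair g (triangular (J ℕ.+ K))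
rectangle≤sum-unpair {g} g≥0 J K =
  ℚ.≤-trans (rectangle≤triangle g≥0 J K) (ℚ.≤-reflexive (sym (sum-triangular g (J ℕ.+ K))))

-- Subdistributions

weight : Dist → ℕ → ℚ
weight D i = proj₁ (D i)

term : Dist → ℕ → Term
term D i = proj₂ (D i)

-- A series of rationals can have an irrational sum, so the total mass is bounded through its
-- partial sums.
record SubDist (D : Dist) : Set where
  field
    nonNeg  : ∀ i → 0ℚ ≤ weight D i
    total≤1 : ∀ n → sum (weight D) n ≤ 1ℚ
open SubDist

mapD-subDist : ∀ {D} f → SubDist D → SubDist (mapD f D)
mapD-subDist f sub = record { nonNeg = nonNeg sub ; total≤1 = total≤1 sub }

dirac-subDist : ∀ M → SubDist (dirac M)
dirac-subDist M = record { nonNeg = nn ; total≤1 = tot }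
  where
  nn : ∀ i → 0ℚ ≤ weight (dirac M) i
  nn zero    = 0≤1
  nn (suc _) = ℚ.≤-refl
  tot : ∀ n → sum (weight (dirac M)) n ≤ 1ℚ
  tot zero          = 0≤1
  tot (suc zero)    = ℚ.≤-refl
  tot (suc (suc n)) = ℚ.≤-trans (ℚ.≤-reflexive (ℚ.+-identityʳ _)) (tot (suc n))

twoPoint-subDist : ∀ M N → SubDist (twoPoint M N)
twoPoint-subDist M N = record { nonNeg = nn ; total≤1 = tot }
  where
  nn : ∀ i → 0ℚ ≤ weight (twoPoint M N) i
  nn zero          = 0≤½
  nn (suc zero)    = 0≤½
  nn (suc (suc _)) = ℚ.≤-refl
  tot : ∀ n → sum (weight (twoPoint M N)) n ≤ 1ℚ
  tot zero                = 0≤1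
  tot (suc zero)          = p≤p+q 0≤½
  tot (suc (suc zero))    = ℚ.≤-refl
  tot (suc (suc (suc n))) = ℚ.≤-trans (ℚ.≤-reflexive (ℚ.+-identityʳ _)) (tot (suc (suc n)))

Rdist-subDist : SubDist Rdist
Rdist-subDist = record
  { nonNeg  = half^-nonNeg ∘ suc
  ; total≤1 = λ n → ℚ.≤-trans (ℚ.≤-reflexive (sum-half^ n)) (p-q≤p (half^-nonNeg n))
  }

-- Values and single reduction steps

data Value : Term → Set where
  lam  : ∀ {M} → Value (lam M)
  zer  : Value zer
  suc′ : ∀ {V} → Value V → Value (suc′ V)
  pair : ∀ {V W} → Value V → Value W → Value (pair V W)
  rec  : Value rec
  X    : Value X

isValue⇒Value : ∀ M → isValue M ≡ true → Value M
isValue⇒Value (lam _)    _ = lam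
isValue⇒Value zer        _ = zer
isValue⇒Value (suc′ M)   v = suc′ (isValue⇒Value M v)
isValue⇒Value (pair M N) v with isValue M in m | isValue N in n
... | true | true = pair (isValue⇒Value M m) (isValue⇒Value N n)
isValue⇒Value rec        _ = rec
isValue⇒Value X          _ = X

Value⇒isValue : ∀ {V} → Value V → isValue V ≡ true
Value⇒isValue lam        = refl
Value⇒isValue zer        = refl
Value⇒isValue (suc′ v)   = Value⇒isValue v
Value⇒isValue (pair v w) rewrite Value⇒isValue v = Value⇒isValue w
Value⇒isValue rec        = refl
Value⇒isValue X          = refl

step-value : ∀ {V} → Value V → step V ≡ dirac V
step-value lam        = refl
step-value zer        = refl
step-value (suc′ v)   rewrite Value⇒isValue v = refl
step-value (pair v w) rewrite Value⇒isValue v | Value⇒isValue w = refl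
step-value rec        = refl
step-value X          = refl

-- The cases split the argument as deeply as the clauses of `redex` inspect it, so that `redex`
-- computes. Only `X` applied to a pair branches.
redex-subDist : ∀ {V W} → Value V → Value W → SubDist (redex V W)
redex-subDist lam _                            = dirac-subDist _
redex-subDist zer _                            = dirac-subDist _
redex-subDist (suc′ _) _                       = dirac-subDist _
redex-subDist (pair _ _) _                     = dirac-subDist _
redex-subDist rec lam                          = dirac-subDist _
redex-subDist rec zer                          = dirac-subDist _
redex-subDist rec (suc′ _)                     = dirac-subDist _
redex-subDist rec rec                          = dirac-subDist _
redex-subDist rec X                            = dirac-subDist _
redex-subDist rec (pair _ lam)                 = dirac-subDist _
redex-subDist rec (pair _ zer)                 = dirac-subDist _
redex-subDist rec (pair _ (suc′ _))            = dirac-subDist _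
redex-subDist rec (pair _ rec)                 = dirac-subDist _
redex-subDist rec (pair _ X)                   = dirac-subDist _
redex-subDist rec (pair _ (pair _ lam))        = dirac-subDist _
redex-subDist rec (pair _ (pair _ zer))        = dirac-subDist _
redex-subDist rec (pair _ (pair _ (suc′ _)))   = dirac-subDist _
redex-subDist rec (pair _ (pair _ (pair _ _))) = dirac-subDist _
redex-subDist rec (pair _ (pair _ rec))        = dirac-subDist _
redex-subDist rec (pair _ (pair _ X))          = dirac-subDist _
redex-subDist X lam                            = dirac-subDist _
redex-subDist X zer                            = dirac-subDist _
redex-subDist X (suc′ _)                       = dirac-subDist _
redex-subDist X (pair _ _)                     = twoPoint-subDist _ _
redex-subDist X rec                            = dirac-subDist _
redex-subDist X X                              = dirac-subDist _

step-π₁-value : ∀ {V} → Value V → SubDist (step (π₁ V))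
step-π₁-value lam        = dirac-subDist _
step-π₁-value zer        = dirac-subDist _
step-π₁-value (suc′ v)   rewrite Value⇒isValue v = dirac-subDist _
step-π₁-value (pair v w) rewrite Value⇒isValue v | Value⇒isValue w = dirac-subDist _
step-π₁-value rec        = dirac-subDist _
step-π₁-value X          = dirac-subDist _

step-π₂-value : ∀ {V} → Value V → SubDist (step (π₂ V))
step-π₂-value lam        = dirac-subDist _
step-π₂-value zer        = dirac-subDist _
step-π₂-value (suc′ v)   rewrite Value⇒isValue v = dirac-subDist _
step-π₂-value (pair v w) rewrite Value⇒isValue v | Value⇒isValue w = dirac-subDist _
step-π₂-value rec        = dirac-subDist _
step-π₂-value X          = dirac-subDist _

step-π₁ : ∀ M → isValue M ≡ false → step (π₁ M) ≡ mapD π₁ (step M)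
step-π₁ M nv rewrite nv = refl

step-π₂ : ∀ M → isValue M ≡ false → step (π₂ M) ≡ mapD π₂ (step M)
step-π₂ M nv rewrite nv = refl

step-subDist : ∀ M → SubDist (step M)
step-subDist (var _)    = dirac-subDist _
step-subDist (lam _)    = dirac-subDist _
step-subDist (app M N) with isValue M in m | isValue N in n
... | false | _     = mapD-subDist (λ M′ → app M′ N) (step-subDist M)
... | true  | false = mapD-subDist (app M) (step-subDist N)
... | true  | true  = redex-subDist (isValue⇒Value M m) (isValue⇒Value N n)
step-subDist zer        = dirac-subDist _
step-subDist (suc′ M) with isValue M
... | true  = dirac-subDist _
... | false = mapD-subDist suc′ (step-subDist M)
step-subDist (pair M N) with isValue M | isValue N
... | false | _     = mapD-subDist (λ M′ → pair M′ N) (step-subDist M)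
... | true  | false = mapD-subDist (pair M) (step-subDist N)
... | true  | true  = dirac-subDist _
step-subDist (π₁ M) = by-value (isValue M) refl
  where
  by-value : ∀ b → isValue M ≡ b → SubDist (step (π₁ M))
  by-value true  v  = step-π₁-value (isValue⇒Value M v)
  by-value false nv rewrite step-π₁ M nv = mapD-subDist π₁ (step-subDist M)
step-subDist (π₂ M) = by-value (isValue M) refl
  where
  by-value : ∀ b → isValue M ≡ b → SubDist (step (π₂ M))
  by-value true  v  = step-π₂-value (isValue⇒Value M v)
  by-value false nv rewrite step-π₂ M nv = mapD-subDist π₂ (step-subDist M)
step-subDist rec        = dirac-subDist _
step-subDist (M ⊕ N)    = twoPoint-subDist M N
step-subDist R          = Rdist-subDist
step-subDist X          = dirac-subDist _

-- The new weights form a double family whose row `j` redistributes the weight of entry `j` along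
-- one step, so each row sums to at most that weight.
stepD-subDist : ∀ {D} → SubDist D → SubDist (stepD D)
stepD-subDist {D} sub = record
  { nonNeg  = λ i → weights≥0 (proj₁ (unpair i)) (proj₂ (unpair i))
  ; total≤1 = λ n → ℚ.≤-trans (sum-unpair≤rows weights≥0 rows≤ n) (total≤1 sub n)
  }
  where
  weights : ℕ → ℕ → ℚ
  weights j k = weight D j * weight (step (term D j)) k
  weights≥0 : ∀ j k → 0ℚ ≤ weights j k
  weights≥0 j k = *-nonNeg (nonNeg sub j) (nonNeg (step-subDist (term D j)) k)
  rows≤ : ∀ j n → sum (weights j) n ≤ weight D j
  rows≤ j n = begin
    sum (weights j) n                                 ≡⟨ sum-*ˡ (weight D j) (weight (step (term D j))) n ⟩
    weight D j * sum (weight (step (term D j))) n     ≤⟨ *-monoˡ (nonNeg sub j) (total≤1 (step-subDist (term D j)) n) ⟩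
    weight D j * 1ℚ                                   ≡⟨ ℚ.*-identityʳ (weight D j) ⟩
    weight D j                                        ∎
    where open ℚ.≤-Reasoning

evalN-subDist : ∀ n M → SubDist (evalN n M)
evalN-subDist zero    M = dirac-subDist M
evalN-subDist (suc n) M = stepD-subDist (evalN-subDist n M)

-- Expectations

expect : Dist → (Term → ℚ) → ℕ → ℚ
expect D f = sum (λ i → weight D i * f (term D i))

valueIndicator : Term → ℚ
valueIndicator M = if isValue M then 1ℚ else 0ℚ

valueIndicator-nonNeg : ∀ M → 0ℚ ≤ valueIndicator M
valueIndicator-nonNeg M with isValue M
... | true  = 0≤1
... | false = ℚ.≤-refl

valueMass≡expect : ∀ D K → valueMass D K ≡ expect D valueIndicator K
valueMass≡expect D zero    = refl
valueMass≡expect D (suc K) = cong₂ _+_ (valueMass≡expect D K) (weight-if (isValue (term D K)))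
  where
  weight-if : ∀ b → (if b then weight D K else 0ℚ) ≡ weight D K * (if b then 1ℚ else 0ℚ)
  weight-if true  = sym (ℚ.*-identityʳ (weight D K))
  weight-if false = sym (ℚ.*-zeroʳ (weight D K))

valueMass≤1 : ∀ n M K → valueMass (evalN n M) K ≤ 1ℚ
valueMass≤1 n M K = ℚ.≤-trans (below-total K) (total≤1 (evalN-subDist n M) K)
  where
  D : Dist
  D = evalN n M
  if≤ : ∀ b {p} → 0ℚ ≤ p → (if b then p else 0ℚ) ≤ p
  if≤ true  _   = ℚ.≤-refl
  if≤ false 0≤p = 0≤p
  below-total : ∀ K → valueMass D K ≤ sum (weight D) K
  below-total zero    = ℚ.≤-refl
  below-total (suc K) = ℚ.+-mono-≤ (below-total K) (if≤ (isValue (term D K)) (nonNeg (evalN-subDist n M) K))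

expect-mono : ∀ {D f g} → SubDist D → (∀ M → f M ≤ g M) → ∀ n → expect D f n ≤ expect D g n
expect-mono {D} sub f≤g = sum-mono λ i → *-monoˡ (nonNeg sub i) (f≤g (term D i))

expect-nonNeg : ∀ {D f} → SubDist D → (∀ M → 0ℚ ≤ f M) → ∀ n → 0ℚ ≤ expect D f n
expect-nonNeg {D} sub f≥0 = sum-nonNeg λ i → *-nonNeg (nonNeg sub i) (f≥0 (term D i))

expect-monoʳ : ∀ {D f m n} → SubDist D → (∀ M → 0ℚ ≤ f M) → m ℕ.≤ n → expect D f m ≤ expect D f n
expect-monoʳ {D} sub f≥0 = sum-monoʳ λ i → *-nonNeg (nonNeg sub i) (f≥0 (term D i))

-- The left side is a finite rectangle of the double sum that `stepD` enumerates, hence it is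
-- covered by a long enough prefix.
expect-step≤expect-stepD : ∀ {D f} → SubDist D → (∀ M → 0ℚ ≤ f M) → ∀ J K →
  expect D (λ M → expect (step M) f K) J ≤ expect (stepD D) f (triangular (J ℕ.+ K))
expect-step≤expect-stepD {D} {f} sub f≥0 J K = begin
  expect D (λ M → expect (step M) f K) J         ≡⟨ sum-cong row J ⟩
  sum (λ j → sum (entries j) K) J                ≤⟨ rectangle≤sum-unpair entries≥0 J K ⟩
  expect (stepD D) f (triangular (J ℕ.+ K))      ∎
  where
  open ℚ.≤-Reasoning
  entries : ℕ → ℕ → ℚ
  entries j k = weight D j * weight (step (term D j)) k * f (term (step (term D j)) k)
  entries≥0 : ∀ j k → 0ℚ ≤ entries j k
  entries≥0 j k = *-nonNeg (*-nonNeg (nonNeg sub j) (nonNeg (step-subDist (term D j)) k)) (f≥0 _)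
  row : ∀ j → weight D j * expect (step (term D j)) f K ≡ sum (entries j) K
  row j = trans (sym (sum-*ˡ (weight D j) _ K))
    (sum-cong (λ k → sym (ℚ.*-assoc (weight D j) (weight (step (term D j)) k) _)) K)

-- Only the first suc K outcomes of each step are kept; keeping at least one makes this monotone in n.
reachProb : ℕ → ℕ → Term → ℚ
reachProb K zero    M = valueIndicator M
reachProb K (suc n) M = expect (step M) (reachProb K n) (suc K)

reachProb-nonNeg : ∀ K n M → 0ℚ ≤ reachProb K n M
reachProb-nonNeg K zero    M = valueIndicator-nonNeg M
reachProb-nonNeg K (suc n) M = expect-nonNeg (step-subDist M) (reachProb-nonNeg K n) (suc K)

reachProb-monoᴷ : ∀ {K L} n M → K ℕ.≤ L → reachProb K n M ≤ reachProb L n M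
reachProb-monoᴷ         zero    M K≤L = ℚ.≤-refl
reachProb-monoᴷ {K} {L} (suc n) M K≤L = ℚ.≤-trans
  (expect-mono (step-subDist M) (λ N → reachProb-monoᴷ n N K≤L) (suc K))
  (expect-monoʳ (step-subDist M) (reachProb-nonNeg L n) (s≤s K≤L))

-- A value steps to itself with weight 1 in the first entry, so one further step loses nothing,
-- however short the truncation; for a non-value the indicator is 0.
reachProb-suc : ∀ K n M → reachProb K n M ≤ reachProb K (suc n) M
reachProb-suc K zero M = by-value (isValue M) refl
  where
  by-value : ∀ b → isValue M ≡ b → valueIndicator M ≤ expect (step M) valueIndicator (suc K)
  by-value false nv = ℚ.≤-trans (ℚ.≤-reflexive (cong (λ b → if b then 1ℚ else 0ℚ) nv))
    (expect-nonNeg (step-subDist M) valueIndicator-nonNeg (suc K))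
  by-value true v = ℚ.≤-trans (at-0 v)
    (expect-monoʳ (step-subDist M) valueIndicator-nonNeg (s≤s (z≤n {K})))
    where
    at-0 : isValue M ≡ true → valueIndicator M ≤ expect (step M) valueIndicator 1
    at-0 v rewrite step-value (isValue⇒Value M v) | v = ℚ.≤-refl
reachProb-suc K (suc n) M = expect-mono (step-subDist M) (reachProb-suc K n) (suc K)

reachProb-mono : ∀ {K L m n} M → K ℕ.≤ L → m ℕ.≤ n → reachProb K m M ≤ reachProb L n M
reachProb-mono {K} {L} {m} M K≤L m≤n = ℚ.≤-trans (reachProb-monoᴷ m M K≤L) (go (ℕ.≤⇒≤′ m≤n))
  where
  go : ∀ {n} → m ℕ.≤′ n → reachProb L m M ≤ reachProb L n M
  go (ℕ.≤′-reflexive refl) = ℚ.≤-refl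
  go (ℕ.≤′-step {n} m≤n)   = ℚ.≤-trans (go m≤n) (reachProb-suc L n M)

-- `evalN` adds a step at the end, whereas `reachProb` unfolds the first step; this form follows the
-- recursion of `reachProb`.
iterate : ℕ → Dist → Dist
iterate zero    D = D
iterate (suc n) D = iterate n (stepD D)

iterate-stepD : ∀ n D → iterate n (stepD D) ≡ stepD (iterate n D)
iterate-stepD zero    D = refl
iterate-stepD (suc n) D = iterate-stepD n (stepD D)

evalN≡iterate : ∀ n M → evalN n M ≡ iterate n (dirac M)
evalN≡iterate zero    M = refl
evalN≡iterate (suc n) M = trans (cong stepD (evalN≡iterate n M)) (sym (iterate-stepD n (dirac M)))

-- Stated for an arbitrary start distribution because a Dirac start is lost after one step. The
-- induction moves one step at a time out of `reachProb` and into the distribution.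
expect-reachProb≤valueMass : ∀ K n {D} → SubDist D → ∀ J →
  Σ ℕ λ L → expect D (reachProb K n) J ≤ valueMass (iterate n D) L
expect-reachProb≤valueMass K zero    {D} sub J = J , ℚ.≤-reflexive (sym (valueMass≡expect D J))
expect-reachProb≤valueMass K (suc n) {D} sub J
  with expect-reachProb≤valueMass K n (stepD-subDist sub) (triangular (J ℕ.+ suc K))
... | L , ≤L = L , ℚ.≤-trans (expect-step≤expect-stepD sub (reachProb-nonNeg K n) J (suc K)) ≤L

reachProb≤valueMass : ∀ K n M → Σ ℕ λ L → reachProb K n M ≤ valueMass (evalN n M) L
reachProb≤valueMass K n M with expect-reachProb≤valueMass K n (dirac-subDist M) 1
... | L , ≤L = L , (begin
  reachProb K n M                      ≡⟨ solve 1 (λ p → p := con 0ℚ :+ con 1ℚ :* p) refl (reachProb K n M) ⟩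
  expect (dirac M) (reachProb K n) 1   ≤⟨ ≤L ⟩
  valueMass (iterate n (dirac M)) L    ≡⟨ cong (λ D → valueMass D L) (evalN≡iterate n M) ⟨
  valueMass (evalN n M) L              ∎)
  where open ℚ.≤-Reasoning

-- Substitution

exts-cong : ∀ {σ τ} → σ ≗ τ → exts σ ≗ exts τ
exts-cong σ≗τ zero    = refl
exts-cong σ≗τ (suc i) = cong (rename suc) (σ≗τ i)

exts-var : ∀ {σ} → σ ≗ var → exts σ ≗ var
exts-var σ≗var zero    = refl
exts-var σ≗var (suc i) = cong (rename suc) (σ≗var i)

exts-ext : ∀ τ ρ → exts τ ∘ ext ρ ≗ exts (τ ∘ ρ)
exts-ext τ ρ zero    = refl
exts-ext τ ρ (suc i) = refl

subst-cong : ∀ {σ τ} → σ ≗ τ → subst σ ≗ subst τ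
subst-cong eq (var i)    = eq i
subst-cong eq (lam M)    = cong lam (subst-cong (exts-cong eq) M)
subst-cong eq (app M N)  = cong₂ app (subst-cong eq M) (subst-cong eq N)
subst-cong eq zer        = refl
subst-cong eq (suc′ M)   = cong suc′ (subst-cong eq M)
subst-cong eq (pair M N) = cong₂ pair (subst-cong eq M) (subst-cong eq N)
subst-cong eq (π₁ M)     = cong π₁ (subst-cong eq M)
subst-cong eq (π₂ M)     = cong π₂ (subst-cong eq M)
subst-cong eq rec        = refl
subst-cong eq (M ⊕ N)    = cong₂ _⊕_ (subst-cong eq M) (subst-cong eq N)
subst-cong eq R          = refl
subst-cong eq X          = refl

subst-var : ∀ {σ} → σ ≗ var → ∀ M → subst σ M ≡ M
subst-var eq (var i)    = eq i
subst-var eq (lam M)    = cong lam (subst-var (exts-var eq) M)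
subst-var eq (app M N)  = cong₂ app (subst-var eq M) (subst-var eq N)
subst-var eq zer        = refl
subst-var eq (suc′ M)   = cong suc′ (subst-var eq M)
subst-var eq (pair M N) = cong₂ pair (subst-var eq M) (subst-var eq N)
subst-var eq (π₁ M)     = cong π₁ (subst-var eq M)
subst-var eq (π₂ M)     = cong π₂ (subst-var eq M)
subst-var eq rec        = refl
subst-var eq (M ⊕ N)    = cong₂ _⊕_ (subst-var eq M) (subst-var eq N)
subst-var eq R          = refl
subst-var eq X          = refl

subst-rename : ∀ τ ρ M → subst τ (rename ρ M) ≡ subst (τ ∘ ρ) M
subst-rename τ ρ (var i)    = refl
subst-rename τ ρ (lam M)    = cong lam (trans (subst-rename (exts τ) (ext ρ) M) (subst-cong (exts-ext τ ρ) M))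
subst-rename τ ρ (app M N)  = cong₂ app (subst-rename τ ρ M) (subst-rename τ ρ N)
subst-rename τ ρ zer        = refl
subst-rename τ ρ (suc′ M)   = cong suc′ (subst-rename τ ρ M)
subst-rename τ ρ (pair M N) = cong₂ pair (subst-rename τ ρ M) (subst-rename τ ρ N)
subst-rename τ ρ (π₁ M)     = cong π₁ (subst-rename τ ρ M)
subst-rename τ ρ (π₂ M)     = cong π₂ (subst-rename τ ρ M)
subst-rename τ ρ rec        = refl
subst-rename τ ρ (M ⊕ N)    = cong₂ _⊕_ (subst-rename τ ρ M) (subst-rename τ ρ N)
subst-rename τ ρ R          = refl
subst-rename τ ρ X          = refl

rename≡subst : ∀ ρ M → rename ρ M ≡ subst (var ∘ ρ) M
rename≡subst ρ M = trans (sym (subst-var (λ _ → refl) (rename ρ M))) (subst-rename var ρ M)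

-- Reading renamings as substitutions by variables reduces this to `subst-rename`, with no further
-- induction on terms.
rename-rename-suc : ∀ ρ M → rename (ext ρ) (rename suc M) ≡ rename suc (rename ρ M)
rename-rename-suc ρ M = begin
  rename (ext ρ) (rename suc M)       ≡⟨ rename≡subst (ext ρ) (rename suc M) ⟩
  subst (var ∘ ext ρ) (rename suc M)  ≡⟨ subst-rename (var ∘ ext ρ) suc M ⟩
  subst (var ∘ suc ∘ ρ) M             ≡⟨ subst-rename (var ∘ suc) ρ M ⟨
  subst (var ∘ suc) (rename ρ M)      ≡⟨ rename≡subst suc (rename ρ M) ⟨
  rename suc (rename ρ M)             ∎
  where open ≡-Reasoning

rename-exts : ∀ ρ σ → rename (ext ρ) ∘ exts σ ≗ exts (rename ρ ∘ σ)
rename-exts ρ σ zero    = refl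
rename-exts ρ σ (suc i) = rename-rename-suc ρ (σ i)

rename-subst : ∀ ρ σ M → rename ρ (subst σ M) ≡ subst (rename ρ ∘ σ) M
rename-subst ρ σ (var i)    = refl
rename-subst ρ σ (lam M)    = cong lam (trans (rename-subst (ext ρ) (exts σ) M) (subst-cong (rename-exts ρ σ) M))
rename-subst ρ σ (app M N)  = cong₂ app (rename-subst ρ σ M) (rename-subst ρ σ N)
rename-subst ρ σ zer        = refl
rename-subst ρ σ (suc′ M)   = cong suc′ (rename-subst ρ σ M)
rename-subst ρ σ (pair M N) = cong₂ pair (rename-subst ρ σ M) (rename-subst ρ σ N)
rename-subst ρ σ (π₁ M)     = cong π₁ (rename-subst ρ σ M)
rename-subst ρ σ (π₂ M)     = cong π₂ (rename-subst ρ σ M)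
rename-subst ρ σ rec        = refl
rename-subst ρ σ (M ⊕ N)    = cong₂ _⊕_ (rename-subst ρ σ M) (rename-subst ρ σ N)
rename-subst ρ σ R          = refl
rename-subst ρ σ X          = refl

subst-exts : ∀ τ σ → subst (exts τ) ∘ exts σ ≗ exts (subst τ ∘ σ)
subst-exts τ σ zero    = refl
subst-exts τ σ (suc i) = trans (subst-rename (exts τ) suc (σ i)) (sym (rename-subst suc τ (σ i)))

subst-subst : ∀ τ σ M → subst τ (subst σ M) ≡ subst (subst τ ∘ σ) M
subst-subst τ σ (var i)    = refl
subst-subst τ σ (lam M)    = cong lam (trans (subst-subst (exts τ) (exts σ) M) (subst-cong (subst-exts τ σ) M))
subst-subst τ σ (app M N)  = cong₂ app (subst-subst τ σ M) (subst-subst τ σ N)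
subst-subst τ σ zer        = refl
subst-subst τ σ (suc′ M)   = cong suc′ (subst-subst τ σ M)
subst-subst τ σ (pair M N) = cong₂ pair (subst-subst τ σ M) (subst-subst τ σ N)
subst-subst τ σ (π₁ M)     = cong π₁ (subst-subst τ σ M)
subst-subst τ σ (π₂ M)     = cong π₂ (subst-subst τ σ M)
subst-subst τ σ rec        = refl
subst-subst τ σ (M ⊕ N)    = cong₂ _⊕_ (subst-subst τ σ M) (subst-subst τ σ N)
subst-subst τ σ R          = refl
subst-subst τ σ X          = refl

infixr 5 _∷ˢ_

_∷ˢ_ : Term → (ℕ → Term) → ℕ → Term
(V ∷ˢ σ) zero    = V
(V ∷ˢ σ) (suc i) = σ i

-- Identifies the contractum of a substituted abstraction with its body under an extended
-- substitution, the form in which the induction hypothesis of `fundamental` applies.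
subst-exts-[] : ∀ σ M V → subst (exts σ) M [ V ] ≡ subst (V ∷ˢ σ) M
subst-exts-[] σ M V = trans (subst-subst (single V) (exts σ) M) (subst-cong pointwise M)
  where
  pointwise : subst (single V) ∘ exts σ ≗ V ∷ˢ σ
  pointwise zero    = refl
  pointwise (suc i) = trans (subst-rename (single V) suc (σ i)) (subst-var (λ _ → refl) (σ i))

-- Reaching a predicate with a given probability

-- Only the first K outcomes of a step are explored; the others count as failure.
data Reach (P : Term → Set) (s : ℚ) (M : Term) : Set where
  giveUp : s ≤ 0ℚ → Reach P s M
  value  : isValue M ≡ true → P M → s ≤ 1ℚ → Reach P s M
  reduce : ∀ {D} → isValue M ≡ false → step M ≡ D → (K : ℕ) (t : ℕ → ℚ) →
           (∀ i → i ℕ.< K → Reach P (t i) (term D i)) →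
           s ≤ sum (λ i → weight D i * t i) K → Reach P s M

-- Bounds of this form come arbitrarily close to 1, and a budget `half^ k` splits evenly between two
-- stages of an evaluation.
Converges : (Term → Set) → Term → Set
Converges P M = ∀ k → Reach P (1ℚ - half^ k) M

reach-weaken : ∀ {P s t M} → s ≤ t → Reach P t M → Reach P s M
reach-weaken s≤t (giveUp t≤0)            = giveUp (ℚ.≤-trans s≤t t≤0)
reach-weaken s≤t (value v p t≤1)         = value v p (ℚ.≤-trans s≤t t≤1)
reach-weaken s≤t (reduce nv eq K u r t≤) = reduce nv eq K u r (ℚ.≤-trans s≤t t≤)

reach-dirac : ∀ {P s M N} → isValue M ≡ false → step M ≡ dirac N → Reach P s N → Reach P s M
reach-dirac {s = s} nv eq r = reduce nv eq 1 (λ _ → s) (λ { zero _ → r ; (suc _) (s≤s ()) })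
  (ℚ.≤-reflexive (solve 1 (λ s → s := con 0ℚ :+ con 1ℚ :* s) refl s))

reach-twoPoint : ∀ {P s t M N₁ N₂} → isValue M ≡ false → step M ≡ twoPoint N₁ N₂ →
  Reach P s N₁ → Reach P t N₂ → Reach P (½ * s + ½ * t) M
reach-twoPoint {P} {s} {t} {N₁ = N₁} {N₂} nv eq r₁ r₂ = reduce nv eq 2 u branches
  (ℚ.≤-reflexive (cong (_+ ½ * t) (sym (ℚ.+-identityˡ (½ * s)))))
  where
  u : ℕ → ℚ
  u zero    = s
  u (suc _) = t
  branches : ∀ i → i ℕ.< 2 → Reach P (u i) (term (twoPoint N₁ N₂) i)
  branches zero          _ = r₁
  branches (suc zero)    _ = r₂
  branches (suc (suc _)) (s≤s (s≤s ()))

-- A semantic notion of context, consisting of the two facts by which a reduction tree for `M` is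
-- transported to one for `E M`, in place of a grammar of contexts.
record EvalContext (E : Term → Term) : Set where
  field
    nonValue : ∀ M → isValue M ≡ false → isValue (E M) ≡ false
    step-in  : ∀ M → isValue M ≡ false → step (E M) ≡ mapD E (step M)
open EvalContext

sum-*-minus : ∀ (w t : ℕ → ℚ) ε n → sum (λ i → w i * (t i - ε)) n ≡ sum (λ i → w i * t i) n - sum w n * ε
sum-*-minus w t ε zero    = solve 1 (λ ε → con 0ℚ := con 0ℚ :- con 0ℚ :* ε) refl ε
sum-*-minus w t ε (suc n) = trans (cong (_+ w n * (t n - ε)) (sum-*-minus w t ε n))
  (solve 5 (λ a b w t ε → a :- b :* ε :+ w :* (t :- ε) := a :+ w :* t :- (b :+ w) :* ε) refl
    (sum (λ i → w i * t i) n) (sum w n) (w n) (t n) ε)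

-- Each value leaf `V` is extended by a tree for `E V` that loses at most `ε`. At an inner node the
-- branch losses are averaged with weights of total at most 1, so the loss stays at most `ε` instead
-- of accumulating with depth.
reach-bind : ∀ {P Q E ε s M} → EvalContext E → 0ℚ ≤ ε →
  (∀ V → P V → Reach Q (1ℚ - ε) (E V)) → Reach P s M → Reach Q (s - ε) (E M)
reach-bind E 0≤ε k (giveUp s≤0) = giveUp (ℚ.≤-trans (p-q≤p 0≤ε) s≤0)
reach-bind {ε = ε} E 0≤ε k (value _ p s≤1) = reach-weaken (ℚ.+-monoˡ-≤ (- ε) s≤1) (k _ p)
reach-bind {ε = ε} {s} {M} E 0≤ε k (reduce nv refl K t r s≤) =
  reduce (nonValue E M nv) (step-in E M nv) K (λ i → t i - ε) (λ i i<K → reach-bind E 0≤ε k (r i i<K)) (begin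
    s - ε                                       ≤⟨ ℚ.+-monoˡ-≤ (- ε) s≤ ⟩
    sum (λ i → w i * t i) K - ε                 ≤⟨ ℚ.+-monoʳ-≤ (sum (λ i → w i * t i) K) (ℚ.neg-antimono-≤ loss≤ε) ⟩
    sum (λ i → w i * t i) K - sum w K * ε       ≡⟨ sum-*-minus w t ε K ⟨
    sum (λ i → w i * (t i - ε)) K               ∎)
  where
  open ℚ.≤-Reasoning
  w : ℕ → ℚ
  w = weight (step M)
  loss≤ε : sum w K * ε ≤ ε
  loss≤ε = begin
    sum w K * ε ≡⟨ ℚ.*-comm (sum w K) ε ⟩
    ε * sum w K ≤⟨ *-monoˡ 0≤ε (SubDist.total≤1 (step-subDist M) K) ⟩
    ε * 1ℚ      ≡⟨ ℚ.*-identityʳ ε ⟩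
    ε           ∎

-- Each of the two stages receives half of the budget `half^ n`.
converges-bind : ∀ {P Q E M} → EvalContext E → (∀ V → P V → Converges Q (E V)) → Converges P M → Converges Q (E M)
converges-bind E k c n = reach-weaken
  (ℚ.≤-reflexive (1-half^-split n))
  (reach-bind E (half^-nonNeg (suc n)) (λ V p → k V p (suc n)) (c (suc n)))

converges-value : ∀ {P V} → isValue V ≡ true → P V → Converges P V
converges-value v p n = value v p (p-q≤p (half^-nonNeg n))

converges-dirac : ∀ {P M N} → isValue M ≡ false → step M ≡ dirac N → Converges P N → Converges P M
converges-dirac nv eq c n = reach-dirac nv eq (c n)

bounded-choice : ∀ {Φ : ℕ → ℕ → Set} → (∀ {i m n} → m ℕ.≤ n → Φ i m → Φ i n) →
  ∀ K → (∀ i → i ℕ.< K → Σ ℕ (Φ i)) → Σ ℕ λ n → ∀ i → i ℕ.< K → Φ i n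
bounded-choice     mono zero    f = 0 , λ _ ()
bounded-choice {Φ} mono (suc K) f with bounded-choice {Φ} mono K (λ i i<K → f i (ℕ.m<n⇒m<1+n i<K)) | f K ℕ.≤-refl
-- The sum serves as a common upper bound of both witnesses.
... | m , φ | n , φK = m ℕ.+ n , at
  where
  at : ∀ i → i ℕ.< suc K → Φ i (m ℕ.+ n)
  at i i<1+K with ℕ.m<1+n⇒m<n∨m≡n i<1+K
  ... | inj₁ i<K  = mono (ℕ.m≤m+n m n) (φ i i<K)
  ... | inj₂ refl = mono (ℕ.m≤n+m n m) φK

-- A tree has finite depth and finite branching, so one number bounds both.
reach⇒reachProb : ∀ {P s M} → Reach P s M → Σ ℕ λ n → s ≤ reachProb n n M
reach⇒reachProb {M = M} (giveUp s≤0)    = 0 , ℚ.≤-trans s≤0 (valueIndicator-nonNeg M)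
reach⇒reachProb {M = M} (value v _ s≤1) = 0 , ℚ.≤-trans s≤1
  (ℚ.≤-reflexive (cong (λ b → if b then 1ℚ else 0ℚ) (sym v)))
reach⇒reachProb {s = s} {M} (reduce nv refl K t r s≤)
  with bounded-choice {λ i n → t i ≤ reachProb n n (term (step M) i)}
         (λ {i} m≤n t≤ → ℚ.≤-trans t≤ (reachProb-mono (term (step M) i) m≤n m≤n))
         K (λ i i<K → reach⇒reachProb (r i i<K))
-- This number must exceed the depth `m` of the subtrees by one and also cover the `K` explored
-- outcomes.
... | m , t≤ = suc (m ℕ.+ K) , (begin
  s
    ≤⟨ s≤ ⟩
  sum (λ i → weight (step M) i * t i) K
    ≤⟨ sum-mono-< K (λ i i<K → *-monoˡ (SubDist.nonNeg sub i) (t≤ i i<K)) ⟩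
  expect (step M) (reachProb m m) K
    ≤⟨ expect-mono sub (λ N → reachProb-mono {L = suc (m ℕ.+ K)} {n = m ℕ.+ K} N
         (ℕ.m≤n⇒m≤1+n (ℕ.m≤m+n m K)) (ℕ.m≤m+n m K)) K ⟩
  expect (step M) (reachProb (suc (m ℕ.+ K)) (m ℕ.+ K)) K
    ≤⟨ expect-monoʳ sub (reachProb-nonNeg (suc (m ℕ.+ K)) (m ℕ.+ K))
         (ℕ.m≤n⇒m≤1+n (ℕ.m≤n⇒m≤1+n (ℕ.m≤n+m K m))) ⟩
  reachProb (suc (m ℕ.+ K)) (suc (m ℕ.+ K)) M ∎)
  where
  open ℚ.≤-Reasoning
  sub : SubDist (step M)
  sub = step-subDist M

converges⇒AST : ∀ {P M} → Converges P M → AST M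
converges⇒AST {P} {M} c = (λ n K → valueMass≤1 n M K) , λ ε 0<ε → close ε (half^-archimedean 0<ε)
  where
  close : ∀ ε → Σ ℕ (λ k → half^ k ≤ ε) → Σ ℕ λ n → Σ ℕ λ K → 1ℚ - ε ≤ valueMass (evalN n M) K
  close ε (k , half≤ε) with reach⇒reachProb (c k)
  ... | n , ≤reachProb with reachProb≤valueMass n n M
  ... | K , ≤valueMass = n , K ,
    ℚ.≤-trans (ℚ.+-monoʳ-≤ 1ℚ (ℚ.neg-antimono-≤ half≤ε)) (ℚ.≤-trans ≤reachProb ≤valueMass)

-- Evaluation contexts

appˡ-context : ∀ N → EvalContext (λ M → app M N)
appˡ-context N = record { nonValue = λ _ _ → refl ; step-in = step-appˡ }
  where
  step-appˡ : ∀ M → isValue M ≡ false → step (app M N) ≡ mapD (λ M′ → app M′ N) (step M)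
  step-appˡ _ nv rewrite nv = refl

appʳ-context : ∀ {V} → isValue V ≡ true → EvalContext (app V)
appʳ-context {V} v = record { nonValue = λ _ _ → refl ; step-in = step-appʳ }
  where
  step-appʳ : ∀ N → isValue N ≡ false → step (app V N) ≡ mapD (app V) (step N)
  step-appʳ _ nv rewrite v | nv = refl

suc-context : EvalContext suc′
suc-context = record { nonValue = λ _ nv → nv ; step-in = step-suc }
  where
  step-suc : ∀ M → isValue M ≡ false → step (suc′ M) ≡ mapD suc′ (step M)
  step-suc _ nv rewrite nv = refl

pairˡ-context : ∀ N → EvalContext (λ M → pair M N)
pairˡ-context N = record { nonValue = λ _ nv → cong (_∧ isValue N) nv ; step-in = step-pairˡ }
  where
  step-pairˡ : ∀ M → isValue M ≡ false → step (pair M N) ≡ mapD (λ M′ → pair M′ N) (step M)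
  step-pairˡ _ nv rewrite nv = refl

pairʳ-context : ∀ {V} → isValue V ≡ true → EvalContext (pair V)
pairʳ-context {V} v = record
  { nonValue = λ _ nv → trans (cong (isValue V ∧_) nv) (∧-zeroʳ (isValue V))
  ; step-in  = step-pairʳ
  }
  where
  step-pairʳ : ∀ N → isValue N ≡ false → step (pair V N) ≡ mapD (pair V) (step N)
  step-pairʳ _ nv rewrite v | nv = refl

π₁-context : EvalContext π₁
π₁-context = record { nonValue = λ _ _ → refl ; step-in = step-π₁ }

π₂-context : EvalContext π₂
π₂-context = record { nonValue = λ _ _ → refl ; step-in = step-π₂ }

-- Reducibility

-- A predicate satisfied by values only; computations are treated through `Converges (Red A)`, as in
-- the clause for functions.
Red : Ty → Term → Set
Red NAT      V = Σ ℕ λ n → V ≡ numeral n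
Red (A ⇒ B)  V = isValue V ≡ true × (∀ W → Red A W → Converges (Red B) (app V W))
Red (A ×ᵗ B) V = Σ Term λ V₁ → Σ Term λ V₂ → V ≡ pair V₁ V₂ × Red A V₁ × Red B V₂

red-value : ∀ A {V} → Red A V → isValue V ≡ true
red-value NAT      (n , refl) = numeral-value n
  where
  numeral-value : ∀ n → isValue (numeral n) ≡ true
  numeral-value zero    = refl
  numeral-value (suc n) = numeral-value n
red-value (A ⇒ B)  (v , _) = v
red-value (A ×ᵗ B) (_ , _ , refl , r₁ , r₂) = cong₂ _∧_ (red-value A r₁) (red-value B r₂)

red-converges : ∀ A {V} → Red A V → Converges (Red A) V
red-converges A r = converges-value (red-value A r) r

-- Convergence of the term formers and constants

step-redex : ∀ V W → isValue V ≡ true → isValue W ≡ true → step (app V W) ≡ redex V W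
step-redex _ _ v w rewrite v | w = refl

app-converges : ∀ A B {M N} → Converges (Red (A ⇒ B)) M → Converges (Red A) N → Converges (Red B) (app M N)
app-converges A B {N = N} cM cN = converges-bind (appˡ-context N)
  (λ V (v , rV) → converges-bind (appʳ-context v) rV cN) cM

pair-converges : ∀ A B {M N} → Converges (Red A) M → Converges (Red B) N → Converges (Red (A ×ᵗ B)) (pair M N)
pair-converges A B {N = N} cM cN = converges-bind (pairˡ-context N)
  (λ V rV → converges-bind (pairʳ-context (red-value A rV))
    (λ W rW → red-converges (A ×ᵗ B) (V , W , refl , rV , rW)) cN) cM

suc-converges : ∀ {M} → Converges (Red NAT) M → Converges (Red NAT) (suc′ M)
suc-converges = converges-bind suc-context λ { _ (n , refl) → red-converges NAT (suc n , refl) }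

π₁-converges : ∀ A B {M} → Converges (Red (A ×ᵗ B)) M → Converges (Red A) (π₁ M)
π₁-converges A B = converges-bind π₁-context λ { _ (V , W , refl , rV , rW) →
  converges-dirac refl (projects V W (red-value A rV) (red-value B rW)) (red-converges A rV) }
  where
  projects : ∀ V W → isValue V ≡ true → isValue W ≡ true → step (π₁ (pair V W)) ≡ dirac V
  projects V W v w rewrite v | w = refl

π₂-converges : ∀ A B {M} → Converges (Red (A ×ᵗ B)) M → Converges (Red B) (π₂ M)
π₂-converges A B = converges-bind π₂-context λ { _ (V , W , refl , rV , rW) →
  converges-dirac refl (projects V W (red-value A rV) (red-value B rW)) (red-converges B rW) }
  where
  projects : ∀ V W → isValue V ≡ true → isValue W ≡ true → step (π₂ (pair V W)) ≡ dirac W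
  projects V W v w rewrite v | w = refl

⊕-converges : ∀ {P M N} → Converges P M → Converges P N → Converges P (M ⊕ N)
⊕-converges cM cN n = reach-weaken
  (ℚ.≤-reflexive (solve 1 (λ s → s := con ½ :* s :+ con ½ :* s) refl (1ℚ - half^ n)))
  (reach-twoPoint refl refl (cM n) (cN n))

-- The first `n` outcomes are numerals of total weight exactly `1 - half^ n`.
R-converges : Converges (Red NAT) R
R-converges n = reduce refl refl n (λ _ → 1ℚ)
  (λ i _ → value (red-value NAT (i , refl)) (i , refl) ℚ.≤-refl)
  (ℚ.≤-reflexive (trans (sym (sum-half^ n)) (sum-cong (λ i → sym (ℚ.*-identityʳ (half^ (suc i)))) n)))

rec-converges : ∀ A {V W} n → Red A V → Red (NAT ⇒ A ⇒ A) W →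
  Converges (Red A) (app rec (pair V (pair W (numeral n))))
rec-converges A {V} {W} n rV rW with red-value (A ×ᵗ (NAT ⇒ A ⇒ A) ×ᵗ NAT) {pair V (pair W (numeral n))}
                                      (_ , _ , refl , rV , _ , _ , refl , rW , n , refl)
rec-converges A {V} {W} zero    rV rW | v =
  converges-dirac refl (step-redex rec (pair V (pair W zer)) refl v) (red-converges A rV)
rec-converges A {V} {W} (suc n) rV rW | v =
  converges-dirac refl (step-redex rec (pair V (pair W (numeral (suc n)))) refl v)
  (app-converges A A (proj₂ rW (numeral n) (n , refl)) (rec-converges A n rV rW))

red-rec : ∀ A → Red ((A ×ᵗ (NAT ⇒ A ⇒ A) ×ᵗ NAT) ⇒ A) rec
red-rec A = refl , λ { _ (_ , _ , refl , rV , _ , _ , refl , rW , n , refl) → rec-converges A n rV rW }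

-- half^ n is the probability that X⟨V,W⟩ is unfolded n times; half^ k pays for truncating the evaluation of V.
X-reach : ∀ A {V W} → Red (A ⇒ A) V → Red A W → ∀ n k →
  Reach (Red A) (1ℚ - half^ n - half^ k) (app X (pair V W))
-- Here `half^ 0` is 1, so nothing has to be reached.
X-reach A rV rW zero k = giveUp (ℚ.≤-trans (ℚ.≤-reflexive (ℚ.+-identityˡ _)) (ℚ.neg-antimono-≤ (half^-nonNeg k)))
X-reach A {V} {W} rV rW (suc n) k = reach-weaken bound
  (reach-twoPoint refl (step-redex X (pair V W) refl (red-value ((A ⇒ A) ×ᵗ A) {pair V W} (_ , _ , refl , rV , rW)))
    -- The inner unfolding and the application of `V` may each lose `half^ (suc k)`. This branch is
    -- taken with probability one half, so the combined loss is `half^ (suc k)`, within the budget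
    -- `half^ k`.
    (reach-bind (appʳ-context (proj₁ rV)) (half^-nonNeg (suc k))
      (λ U rU → proj₂ rV U rU (suc k)) (X-reach A rV rW n (suc k)))
    (value (red-value A rW) rW ℚ.≤-refl))
  where
  open ℚ.≤-Reasoning
  bound : 1ℚ - half^ (suc n) - half^ k ≤ ½ * (1ℚ - half^ n - half^ (suc k) - half^ (suc k)) + ½ * 1ℚ
  bound = begin
    1ℚ - ½ * half^ n - half^ k
      ≤⟨ ℚ.+-monoʳ-≤ (1ℚ - ½ * half^ n) (ℚ.neg-antimono-≤ half≤) ⟩
    1ℚ - ½ * half^ n - ½ * half^ k
      ≡⟨ solve 2 (λ a b → con 1ℚ :- con ½ :* a :- con ½ :* b :=
           con ½ :* (con 1ℚ :- a :- con ½ :* b :- con ½ :* b) :+ con ½ :* con 1ℚ) refl (half^ n) (half^ k) ⟩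
    ½ * (1ℚ - half^ n - half^ (suc k) - half^ (suc k)) + ½ * 1ℚ ∎
    where
    half≤ : ½ * half^ k ≤ half^ k
    half≤ = ℚ.≤-trans (p≤p+q (half^-nonNeg (suc k))) (ℚ.≤-reflexive (sym (half^-double k)))

-- Cutting the unfoldings and truncating the evaluation of `V` each cost `half^ (suc n)`, together
-- `half^ n`.
red-X : ∀ A → Red (((A ⇒ A) ×ᵗ A) ⇒ A) X
red-X A = refl , λ { _ (_ , _ , refl , rV , rW) n → reach-weaken
  (ℚ.≤-reflexive (1-half^-split n))
  (X-reach A rV rW (suc n) (suc n)) }

-- Fundamental lemma of the logical relation

RedSubst : List Ty → (ℕ → Term) → Set
RedSubst Γ σ = ∀ {i A} → Γ ∋ i ∶ A → Red A (σ i)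

_∷ʳ_ : ∀ {Γ A V σ} → Red A V → RedSubst Γ σ → RedSubst (A ∷ Γ) (V ∷ˢ σ)
(rV ∷ʳ rσ) here      = rV
(rV ∷ʳ rσ) (there x) = rσ x

fundamental : ∀ {Γ M A σ} → Γ ⊢ M ∶ A → RedSubst Γ σ → Converges (Red A) (subst σ M)
fundamental {A = A} (⊢var x) rσ = red-converges A (rσ x)
fundamental {σ = σ} (⊢lam {M} {A} {B} ⊢M) rσ = red-converges (A ⇒ B) (refl , λ W rW →
  converges-dirac refl (step-redex (lam (subst (exts σ) M)) W refl (red-value A rW))
    (transport (Converges (Red B)) (sym (subst-exts-[] σ M W)) (fundamental ⊢M (rW ∷ʳ rσ))))
fundamental (⊢app {A = A} {B} ⊢M ⊢N) rσ = app-converges A B (fundamental ⊢M rσ) (fundamental ⊢N rσ)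
fundamental ⊢zer rσ = red-converges NAT (0 , refl)
fundamental (⊢suc ⊢M) rσ = suc-converges (fundamental ⊢M rσ)
fundamental (⊢pair {A = A} {B} ⊢M ⊢N) rσ = pair-converges A B (fundamental ⊢M rσ) (fundamental ⊢N rσ)
fundamental (⊢π₁ {A = A} {B} ⊢M) rσ = π₁-converges A B (fundamental ⊢M rσ)
fundamental (⊢π₂ {A = A} {B} ⊢M) rσ = π₂-converges A B (fundamental ⊢M rσ)
fundamental (⊢rec {A}) rσ = red-converges ((A ×ᵗ (NAT ⇒ A ⇒ A) ×ᵗ NAT) ⇒ A) (red-rec A)
fundamental (⊢⊕ ⊢M ⊢N) rσ = ⊕-converges (fundamental ⊢M rσ) (fundamental ⊢N rσ)
fundamental ⊢R rσ = R-converges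
fundamental (⊢X {A}) rσ = red-converges (((A ⇒ A) ×ᵗ A) ⇒ A) (red-X A)

mainTheorem6 : (M : Term) (A : Ty) → [] ⊢ M ∶ A → AST M
mainTheorem6 M A ⊢M = converges⇒AST
  -- The identity substitution is vacuously reducible for the empty context and leaves `M`
  -- unchanged.
  (transport (Converges (Red A)) (subst-var (λ _ → refl) M) (fundamental {σ = var} ⊢M λ ()))
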